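{- Let $H$ be a $\{1,2\}$-graph such that its level graph $H^2$ is not bipartite. Then $$\pi(H)=2-\frac{1}{\chi(H^2)-1},$$ where $\chi(H^2)$ is the chromatic number of the graph $H^2$.
   Context: A hypergraph $H=(V,E)$ has edges that are subsets of $V$; its set of edge types is $R(H)=\{|F|:F\in E\}$, and $H$ is called an $R(H)$-graph; a $\{1,2\}$-graph has edges of sizes 1 and 2. For $j\in R(H)$, $H^j$ is the hypergraph of all edges of $H$ with $j$ vertices. The complete hypergraph $K^R_n$ on $[n]$ has edge set $\bigcup_{i\in R}\binom{[n]}{i}$. For a hypergraph $G$ on $n$ vertices, its Lubell function is $h_n(G)=\sum_{k\in R(G)}|E(G^k)|/\binom{n}{k}$. For a hypergraph $F$ with $R=R(F)$, the Turán density is $$\pi(F)=\lim_{n\to\infty}\max\{h_n(G): |V(G)|=n,\ G\subseteq K^R_n,\ G\text{ contains no subgraph isomorphic to }F\}$$ (this limit exists). -}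

module Defs where

open import Data.Bool using (Bool; true; false; _∧_; _∨_)
open import Data.Nat using (ℕ; zero; suc; _<ᵇ_; _≥_; _≤_)
open import Data.Nat.Combinatorics using (_C_)
open import Data.Fin using (Fin; toℕ)
open import Data.List using (List; length; filterᵇ; allFin; cartesianProduct)
open import Data.Product using (Σ; ∃; _×_; _,_)
open import Data.Integer using (+_)
open import Data.Rational using (ℚ; _/_; 0ℚ; _+_; _-_; _<_)
import Data.Rational as Q
open import Relation.Binary.PropositionalEquality using (_≡_; _≢_)
open import Relation.Nullary using (¬_)
open import Function.Definitions using (Injective)

-- A {1,2}-hypergraph (edges of size at most... only sizes 1 and 2) on vertex set Fin n.
-- one v = true   iff  {v} is an edge.
-- two i j (only used for toℕ i < toℕ j) = true  iff  {i,j} is an edge.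
-- Every hypergraph G ⊆ K^{{1,2}}_n is encoded this way (entries with toℕ i ≥ toℕ j are ignored).
record Graph12 (n : ℕ) : Set where
  field
    one : Fin n → Bool
    two : Fin n → Fin n → Bool
open Graph12 public

adj : ∀ {n} → Graph12 n → Fin n → Fin n → Bool
adj G i j = ((toℕ i <ᵇ toℕ j) ∧ two G i j) ∨ ((toℕ j <ᵇ toℕ i) ∧ two G j i)

edges1 : ∀ {n} → Graph12 n → ℕ
edges1 {n} G = length (filterᵇ (one G) (allFin n))

edges2 : ∀ {n} → Graph12 n → ℕ
edges2 {n} G = length (filterᵇ (λ p → (toℕ (Data.Product.proj₁ p) <ᵇ toℕ (Data.Product.proj₂ p)) ∧ two G (Data.Product.proj₁ p) (Data.Product.proj₂ p))
                               (cartesianProduct (allFin n) (allFin n)))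

-- a / b as a rational, with the (irrelevant) convention a / 0 = 0
frac : ℕ → ℕ → ℚ
frac a zero = 0ℚ
frac a (suc b) = (+ a) / suc b

-- R(G) = {1,2} or subsets; terms with no edges contribute 0 anyway
-- Lubell function h_n(G) = |E(G^1)|/C(n,1) + |E(G^2)|/C(n,2)
lubell : ∀ {n} → Graph12 n → ℚ
lubell {n} G = frac (edges1 G) (n C 1) + frac (edges2 G) (n C 2)

Is12Graph : ∀ {m} → Graph12 m → Set
Is12Graph {m} H = (∃ λ v → one H v ≡ true) × (∃ λ i → ∃ λ j → adj H i j ≡ true)

Contains : ∀ {n m} → Graph12 n → Graph12 m → Set
Contains {n} {m} G H =
  Σ (Fin m → Fin n) λ φ → Injective _≡_ _≡_ φ
    × (∀ v → one H v ≡ true → one G (φ v) ≡ true)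
    × (∀ i j → adj H i j ≡ true → adj G (φ i) (φ j) ≡ true)

Colourable : ∀ {m} → Graph12 m → ℕ → Set
Colourable {m} H k =
  Σ (Fin m → Fin k) λ c → ∀ i j → adj H i j ≡ true → c i ≢ c j

Bipartite2 : ∀ {m} → Graph12 m → Set
Bipartite2 H = Colourable H 2

IsChromaticNumber : ∀ {m} → Graph12 m → ℕ → Set
IsChromaticNumber H k = Colourable H k × (∀ j → Colourable H j → k ≤ j)

-- π(H) = L, i.e. lim_{n→∞} max{ h_n(G) : G ⊆ K^{1,2}_n, G H-free } = L, unfolded:
-- for every ε > 0 there is N such that for all n ≥ N the maximum lies in [L-ε, L+ε].
TuranDensityIs : ∀ {m} → Graph12 m → ℚ → Set
TuranDensityIs H L =
  ∀ (ε : ℚ) → 0ℚ < ε → ∃ λ N → ∀ n → n ≥ N →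
    ((G : Graph12 n) → ¬ Contains G H → lubell G Q.≤ L + ε)
    × (Σ (Graph12 n) λ G → ¬ Contains G H × L - ε Q.≤ lubell G)

{-# OPTIONS --safe #-}
module Submission where

-- Let r = χ − 1 ≥ 2. The lower bound is the balanced complete r-partite graph with all
-- singletons. For the upper bound let X be the set of vertices v with {v} an edge of G, and put
-- p/q = 1 − 1/r + 1/(rk). Since r ≥ 2, a Lubell value above 2 − 1/r + 1/k forces
-- 2 e(X) ≥ (p/q) |X|² + c for any constant c, once G is large. Deleting vertices of low degree
-- leaves a large S ⊆ X of minimum degree about (p/q) |S|, and S contains a complete χ-partite
-- graph with large parts (Erdős–Stone), into which H embeds along a χ-colouring.

open import Defs
open import Data.Bool using (Bool; true; false; _∧_; _∨_; T; T?; not)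
open import Data.Bool.Properties using (T-≡; ∨-comm)
open import Data.Fin using (Fin; zero; suc; toℕ; fromℕ<; inject≤)
open import Data.Fin.Properties using (toℕ<n; toℕ-injective; fromℕ<-injective; inject≤-injective) renaming (_≟_ to _≟ᶠ_)
open import Data.Integer as ℤ using (-[1+_])
import Data.Integer.Properties as ℤ
open import Data.List using (List; []; _∷_; _++_; map; length; filterᵇ; take; concat; lookup; allFin; tabulate; cartesianProduct)
open import Data.List.Membership.Propositional using (_∈_; find)
open import Data.List.Membership.Propositional.Properties using (∈-∃++; ∈-filter⁻; ∈-concat⁺′; ∈-lookup)
open import Data.List.Properties using (length-take; length-filter; length-++; length-map; length-tabulate)
open import Data.List.Relation.Binary.Permutation.Propositional using (_↭_; ↭⇒↭ₛ; ↭-sym)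
open import Data.List.Relation.Binary.Permutation.Propositional.Properties using (shift; ∈-resp-↭; ↭-length) renaming (map⁺ to ↭-map⁺)
open import Data.List.Relation.Binary.Permutation.Setoid.Properties using (Unique-resp-↭)
open import Data.List.Relation.Binary.Subset.Propositional using (_⊆_)
open import Data.List.Relation.Unary.All as All using (All; []; _∷_)
import Data.List.Relation.Unary.All.Properties as All
open import Data.List.Relation.Unary.All.Properties.Core using (¬All⇒Any¬)
open import Data.List.Relation.Unary.AllPairs as AllPairs using (AllPairs; []; _∷_)
import Data.List.Relation.Unary.AllPairs.Properties as AllPairs
open import Data.List.Relation.Unary.Any using (Any; here; there)
open import Data.List.Relation.Unary.Unique.Propositional using (Unique)
import Data.List.Relation.Unary.Unique.Propositional.Properties as Unique
open import Data.Nat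
open import Data.Nat.Combinatorics using (_C_; nC1≡n; nCk+nC[k+1]≡[n+1]C[k+1])
open import Data.Nat.DivMod using (_%_; _/_; m%n<n; m<n⇒m%n≡m; [m+n]%n≡m%n; m≡m%n+[m/n]*n)
open import Data.Nat.ListAction using (sum)
open import Data.Nat.ListAction.Properties using (sum-↭)
open import Data.Nat.Properties
open import Data.Nat.Tactic.RingSolver using (solve-∀)
open import Data.Product using (∃; _×_; _,_; proj₁; proj₂)
open import Data.Rational as ℚ using (ℚ; mkℚ; 0ℚ; toℚᵘ)
import Data.Rational.Properties as ℚ
open import Data.Rational.Unnormalised as ℚᵘ using (mkℚᵘ; *≤*)
import Data.Rational.Unnormalised.Properties as ℚᵘ
open import Data.Sum using (inj₁; inj₂)
open import Function using (_∘_; id; Equivalence; it)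
open import Function.Definitions using (Injective)
open import Relation.Binary.Definitions using (tri<; tri≈; tri>)
open import Relation.Binary.PropositionalEquality
open import Relation.Nullary using (¬_; Dec; yes; no; does; ¬?; contradiction)
open import Relation.Nullary.Decidable using (decidable-stable)

-- The embedding must stay inside X, while the Lubell function lets a host trade singletons for
-- pairs. Let |X| = αn. A Lubell value above 2 - 1/r gives 2e(G) of about (2 - 1/r - α)n², and at
-- most (1 - α²)n² ordered pairs lie outside X, so 2e(X)/n² is at least about 1 - 1/r - α + α². This
-- exceeds the target (1 - 1/r)α² by (1 - α)(1 - (1 + α)/r), which is nonnegative for every α ≤ 1
-- once r ≥ 2. This is where χ ≥ 3 matters. Of the extra density 1/k only 1/(rk) is kept in p/q; the
-- remainder pays for c and for the lower-order terms. With p = (r - 1)k + 1 and q = rk one has q -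
-- p = k - 1, so s(1 - p/q) stays below 1 for all s ≤ r, which is what the step from s to s + 1
-- parts requires.

variable
  A B : Set

-- Finite sums over lists.

∑ : List A → (A → ℕ) → ℕ
∑ xs f = sum (map f xs)

infix 6.5 ∑
syntax ∑ xs (λ x → e) = ∑[ x ∈ xs ] e

𝟙 : Bool → ℕ
𝟙 false = 0
𝟙 true  = 1

𝟙≤1 : ∀ b → 𝟙 b ≤ 1
𝟙≤1 false = z≤n
𝟙≤1 true  = ≤-refl

∑-mono : ∀ (xs : List A) {f g} → (∀ {x} → x ∈ xs → f x ≤ g x) → ∑ xs f ≤ ∑ xs g
∑-mono []       f≤g = z≤n
∑-mono (x ∷ xs) f≤g = +-mono-≤ (f≤g (here refl)) (∑-mono xs (f≤g ∘ there))

∑-cong : ∀ (xs : List A) {f g : A → ℕ} → (∀ x → f x ≡ g x) → ∑ xs f ≡ ∑ xs g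
∑-cong []       f≡g = refl
∑-cong (x ∷ xs) f≡g = cong₂ _+_ (f≡g x) (∑-cong xs f≡g)

∑-+ : ∀ (xs : List A) (f g : A → ℕ) → ∑ xs (λ x → f x + g x) ≡ ∑ xs f + ∑ xs g
∑-+ []       f g = refl
∑-+ (x ∷ xs) f g = trans (cong (f x + g x +_) (∑-+ xs f g)) (interchange (f x) (g x) (∑ xs f) (∑ xs g))
  where
  interchange : ∀ a b c d → a + b + (c + d) ≡ a + c + (b + d)
  interchange = solve-∀

∑-const : ∀ (xs : List A) c → ∑ xs (λ _ → c) ≡ length xs * c
∑-const []       c = refl
∑-const (x ∷ xs) c = cong (c +_) (∑-const xs c)

∑-* : ∀ (xs : List A) c (f : A → ℕ) → ∑ xs (λ x → c * f x) ≡ c * ∑ xs f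
∑-* []       c f = sym (*-zeroʳ c)
∑-* (x ∷ xs) c f = trans (cong (c * f x +_) (∑-* xs c f)) (sym (*-distribˡ-+ c (f x) (∑ xs f)))

∑-swap : ∀ (xs : List A) (ys : List B) (f : A → B → ℕ) →
         ∑ xs (λ x → ∑ ys (f x)) ≡ ∑ ys (λ y → ∑ xs (λ x → f x y))
∑-swap []       ys f = sym (trans (∑-const ys 0) (*-zeroʳ (length ys)))
∑-swap (x ∷ xs) ys f =
  trans (cong (∑ ys (f x) +_) (∑-swap xs ys f)) (sym (∑-+ ys (f x) (λ y → ∑ xs (λ x′ → f x′ y))))

∑-++ : ∀ (xs ys : List A) (f : A → ℕ) → ∑ (xs ++ ys) f ≡ ∑ xs f + ∑ ys f
∑-++ []       ys f = refl
∑-++ (x ∷ xs) ys f = trans (cong (f x +_) (∑-++ xs ys f)) (sym (+-assoc (f x) (∑ xs f) (∑ ys f)))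

∑-↭ : ∀ {xs ys : List A} (f : A → ℕ) → xs ↭ ys → ∑ xs f ≡ ∑ ys f
∑-↭ f xs↭ys = sum-↭ (↭-map⁺ f xs↭ys)

length-filterᵇ : ∀ (p : A → Bool) xs → length (filterᵇ p xs) ≡ ∑[ x ∈ xs ] 𝟙 (p x)
length-filterᵇ p []       = refl
length-filterᵇ p (x ∷ xs) with p x
... | true  = cong suc (length-filterᵇ p xs)
... | false = length-filterᵇ p xs

∑-filterᵇ : ∀ (p : A → Bool) f xs → ∑ (filterᵇ p xs) f ≡ ∑[ x ∈ xs ] 𝟙 (p x) * f x
∑-filterᵇ p f []       = refl
∑-filterᵇ p f (x ∷ xs) with p x
... | true  = cong₂ _+_ (sym (+-identityʳ (f x))) (∑-filterᵇ p f xs)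
... | false = ∑-filterᵇ p f xs

∈-filterᵇ⁻ : ∀ (p : A → Bool) {x} xs → x ∈ filterᵇ p xs → x ∈ xs × p x ≡ true
∈-filterᵇ⁻ p xs x∈ with x∈xs , px ← ∈-filter⁻ (T? ∘ p) {xs = xs} x∈ = x∈xs , Equivalence.to T-≡ px

take-⊆ : ∀ n (xs : List A) → take n xs ⊆ xs
take-⊆ (suc n) (x ∷ xs) (here x≡)  = here x≡
take-⊆ (suc n) (x ∷ xs) (there x∈) = there (take-⊆ n xs x∈)

length-take-≤ : ∀ n (xs : List A) → n ≤ length xs → length (take n xs) ≡ n
length-take-≤ n xs n≤ = trans (length-take n xs) (m≤n⇒m⊓n≡m n≤)

∈⇒↭∷ : ∀ {x : A} {xs} → x ∈ xs → ∃ λ xs′ → xs ↭ x ∷ xs′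
∈⇒↭∷ {x = x} x∈ with ys , zs , refl ← ∈-∃++ x∈ = ys ++ zs , shift x ys zs

-- The equation is a subtraction-free form of a − b = (y − x) + z, so that solve-∀ can prove it.
+-compensate-≤ : ∀ {a b x y z} → x ≤ y → a + x ≡ b + y + z → b ≤ a
+-compensate-≤ {a} {b} {x} {y} {z} x≤y eq = +-cancelʳ-≤ x b a (begin
  b + x     ≤⟨ +-monoʳ-≤ b x≤y ⟩
  b + y     ≤⟨ m≤m+n (b + y) z ⟩
  b + y + z ≡⟨ eq ⟨
  a + x     ∎)
  where open ≤-Reasoning

-- Pigeonhole: sublists on which finitely many predicates are constant.

HomogeneousSubset : (B → A → Bool) → List B → List A → ℕ → Set
HomogeneousSubset p bs xs t = ∃ λ ys → ys ⊆ xs × Unique ys × t ≤ length ys ×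
  (∀ {b} → b ∈ bs → ∀ {x y} → x ∈ ys → y ∈ ys → p b x ≡ p b y)

-- The tail of `bs` is asked for 2t elements, and one of the two classes of `p b` keeps at least t
-- of them. Each element of `bs` thus costs a factor 2.
homogeneous : ∀ (p : B → A → Bool) bs xs t → Unique xs → t * 2 ^ length bs ≤ length xs →
              HomogeneousSubset p bs xs t
homogeneous p []       xs t uxs t≤ =
  xs , (λ x∈ → x∈) , uxs , subst (_≤ length xs) (*-identityʳ t) t≤ , λ ()
homogeneous p (b ∷ bs) xs t uxs t≤
  with homogeneous p bs xs (2 * t) uxs (subst (_≤ length xs) (double t (2 ^ length bs)) t≤)
  where
  double : ∀ t m → t * (2 * m) ≡ 2 * t * m
  double = solve-∀
... | ys , ys⊆ , uys , 2t≤ , hom = helper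
  where
  yes-part no-part : List _
  yes-part = filterᵇ (p b) ys
  no-part  = filterᵇ (not ∘ p b) ys

  split : ∀ zs → length (filterᵇ (p b) zs) + length (filterᵇ (not ∘ p b) zs) ≡ length zs
  split [] = refl
  split (z ∷ zs) with p b z
  ... | true  = cong suc (split zs)
  ... | false = trans (+-suc _ _) (cong suc (split zs))

  result : ∀ (q : _ → Bool) → (∀ {x y} → q x ≡ true → q y ≡ true → p b x ≡ p b y) →
           t ≤ length (filterᵇ q ys) → HomogeneousSubset p (b ∷ bs) xs t
  result q q-hom t≤q = filterᵇ q ys , ys⊆ ∘ proj₁ ∘ ∈-filterᵇ⁻ q ys , Unique.filter⁺ (T? ∘ q) uys , t≤q ,
    λ where
      (here refl) x∈ y∈ → q-hom (proj₂ (∈-filterᵇ⁻ q ys x∈)) (proj₂ (∈-filterᵇ⁻ q ys y∈))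
      (there b∈)  x∈ y∈ → hom b∈ (proj₁ (∈-filterᵇ⁻ q ys x∈)) (proj₁ (∈-filterᵇ⁻ q ys y∈))

  not-injective : ∀ {x y} → not x ≡ true → not y ≡ true → x ≡ y
  not-injective {false} {false} _ _ = refl

  helper : HomogeneousSubset p (b ∷ bs) xs t
  helper with t ≤? length yes-part
  ... | yes t≤y = result (p b) (λ px py → trans px (sym py)) t≤y
  ... | no  t≰y = result (not ∘ p b) not-injective
    (+-cancelˡ-≤ t _ _ (begin
      t + t                             ≡⟨ cong (t +_) (+-identityʳ t) ⟨
      2 * t                             ≤⟨ 2t≤ ⟩
      length ys                         ≡⟨ split ys ⟨
      length yes-part + length no-part  ≤⟨ +-monoˡ-≤ _ (<⇒≤ (≰⇒> t≰y)) ⟩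
      t + length no-part                ∎))
    where open ≤-Reasoning

-- Degrees in simple graphs and subsets of large minimum degree.

record SimpleGraph (V : Set) : Set where
  field
    _~_      : V → V → Bool
    ~-sym    : ∀ x y → (x ~ y) ≡ (y ~ x)
    ~-irrefl : ∀ x → (x ~ x) ≡ false

module _ {V : Set} (Γ : SimpleGraph V) where

  open SimpleGraph Γ

  deg : V → List V → ℕ
  deg v S = ∑[ w ∈ S ] 𝟙 (v ~ w)

  -- Counts every edge inside S twice.
  vol : List V → ℕ
  vol S = ∑[ v ∈ S ] deg v S

  -- Roughly deg ≥ (p/q)|S|. The summand `p` comes from |S|² - (|S| - 1)² = 2|S| - 1: deleting a
  -- vertex that fails the inequality strictly raises q vol S - p|S|².
  HighDegree : ℕ → ℕ → List V → V → Set
  HighDegree p q S v = 2 * (p * length S) ≤ 2 * (q * deg v S) + p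

  deg-sym : ∀ (S R : List V) → ∑[ v ∈ S ] deg v R ≡ ∑[ w ∈ R ] deg w S
  deg-sym S R = trans (∑-swap S R _) (∑-cong R λ w → ∑-cong S λ v → cong 𝟙 (~-sym v w))

  deg≤length : ∀ v S → deg v S ≤ length S
  deg≤length v S = begin
    deg v S          ≤⟨ ∑-mono S (λ {w} _ → 𝟙≤1 (v ~ w)) ⟩
    ∑[ _ ∈ S ] 1     ≡⟨ ∑-const S 1 ⟩
    length S * 1     ≡⟨ *-identityʳ _ ⟩
    length S         ∎
    where open ≤-Reasoning

  vol≤length² : ∀ S → vol S ≤ length S * length S
  vol≤length² S = ≤-trans (∑-mono S λ {v} _ → deg≤length v S) (≤-reflexive (∑-const S (length S)))

  deg-↭∷ : ∀ {v S S′} → S ↭ v ∷ S′ → deg v S ≡ deg v S′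
  deg-↭∷ {v} {S} {S′} S↭ = trans (∑-↭ _ S↭) (cong (λ b → 𝟙 b + deg v S′) (~-irrefl v))

  vol-↭∷ : ∀ {v S S′} → S ↭ v ∷ S′ → vol S ≡ vol S′ + 2 * deg v S
  vol-↭∷ {v} {S} {S′} S↭ = begin
    vol S                                                  ≡⟨ ∑-↭ _ S↭ ⟩
    deg v S + ∑[ w ∈ S′ ] deg w S                          ≡⟨ cong (deg v S +_) (∑-cong S′ λ w → ∑-↭ _ S↭) ⟩
    deg v S + (∑[ w ∈ S′ ] (𝟙 (w ~ v) + deg w S′))       ≡⟨ cong (deg v S +_) (∑-+ S′ _ _) ⟩
    deg v S + ((∑[ w ∈ S′ ] 𝟙 (w ~ v)) + vol S′)         ≡⟨ cong (λ d → deg v S + (d + vol S′)) d≡ ⟩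
    deg v S + (deg v S + vol S′)                           ≡⟨ arrange (deg v S) (vol S′) ⟩
    vol S′ + 2 * deg v S                                   ∎
    where
    open ≡-Reasoning
    d≡ : ∑[ w ∈ S′ ] 𝟙 (w ~ v) ≡ deg v S
    d≡ = trans (∑-cong S′ λ w → cong 𝟙 (~-sym w v)) (sym (deg-↭∷ S↭))
    arrange : ∀ d e → d + (d + e) ≡ e + 2 * d
    arrange = solve-∀

  deletion-identity : ∀ p q c ℓ e d →
    q * e + (p * ((1 + ℓ) * (1 + ℓ)) + c + (2 * (q * d) + p)) ≡
    p * (ℓ * ℓ) + c + (q * (e + 2 * d) + 2 * (p * (1 + ℓ))) + 0
  deletion-identity = solve-∀

  -- Deleting a vertex of low degree does not decrease q vol S − p |S|².
  minDegreeSubset : ∀ p q c ℓ S → length S ≡ ℓ → Unique S → p * (ℓ * ℓ) + c ≤ q * vol S →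
                    ∃ λ S′ → S′ ⊆ S × Unique S′ × c ≤ q * (length S′ * length S′) ×
                      All (HighDegree p q S′) S′
  minDegreeSubset p q c ℓ S |S|≡ℓ uS dense
    with All.search (λ v → ¬? (2 * (p * length S) ≤? 2 * (q * deg v S) + p)) S
  ... | inj₁ none-low =
    S , id , uS ,
    -- The surplus `c` survives all deletions, and vol S ≤ |S|², so `c` bounds the size of the final
    -- set from below.
    ≤-trans (m≤n+m c _) (≤-trans dense (*-monoʳ-≤ q (vol≤length² S))) ,
    All.map (λ {v} → decidable-stable (2 * (p * length S) ≤? 2 * (q * deg v S) + p)) none-low
  minDegreeSubset p q c zero (_ ∷ _) () uS dense | inj₂ _
  minDegreeSubset p q c (suc ℓ) S |S|≡ uS dense | inj₂ some-low
    with v , v∈S , low ← find some-low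
    with S′ , S↭ ← ∈⇒↭∷ v∈S
    with _ ∷ uS′ ← Unique-resp-↭ (setoid V) (↭⇒↭ₛ S↭) uS
    with S″ , S″⊆S′ , rest ← minDegreeSubset p q c ℓ S′
      (suc-injective (trans (sym (↭-length S↭)) |S|≡)) uS′
      (+-compensate-≤ {z = 0}
        (+-mono-≤ (subst (λ e → p * (suc ℓ * suc ℓ) + c ≤ q * e) (vol-↭∷ S↭) dense)
                  (subst (λ l → 2 * (q * deg v S) + p ≤ 2 * (p * l)) |S|≡ (<⇒≤ (≰⇒> low))))
        (deletion-identity p q c ℓ (vol S′) (deg v S)))
    = S″ , (λ x∈ → ∈-resp-↭ (↭-sym S↭) (there (S″⊆S′ x∈))) , rest

  -- Erdős-Stone: complete multipartite subgraphs with large parts.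

  Complete : List V → List V → Set
  Complete B B′ = ∀ {x y} → x ∈ B → y ∈ B′ → (x ~ y) ≡ true

  IsPart : ℕ → List V → List V → Set
  IsPart t S B = B ⊆ S × Unique B × length B ≡ t

  -- Disjointness of the parts is implied: distinct parts are completely joined and `_~_` is
  -- irreflexive. A new part can therefore be chosen without avoiding the old ones.
  IsBlowup : ℕ → ℕ → List V → List (List V) → Set
  IsBlowup s t S Bs = length Bs ≡ s × All (IsPart t S) Bs × AllPairs Complete Bs

  length-concat : ∀ {T S} Bs → All (IsPart T S) Bs → length (concat Bs) ≡ length Bs * T
  length-concat []       []                      = refl
  length-concat (B ∷ Bs) ((_ , _ , refl) ∷ parts) =
    trans (length-++ B) (cong (length B +_) (length-concat Bs parts))

  module _ {T : ℕ} {S : List V} where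

    ∑deg≤ : ∀ v Bs → All (IsPart T S) Bs → ∑[ B ∈ Bs ] deg v B ≤ length Bs * T
    ∑deg≤ v []       []                       = z≤n
    ∑deg≤ v (B ∷ Bs) ((_ , _ , refl) ∷ parts) = +-mono-≤ (deg≤length v B) (∑deg≤ v Bs parts)

    -- The deficient part contributes at most `t` and each other part at most its size. `T` is added
    -- on the left because subtracting it on the right would truncate.
    ∑deg-bad≤ : ∀ t v Bs → All (IsPart T S) Bs → Any (λ B → ¬ t ≤ deg v B) Bs →
                ∑[ B ∈ Bs ] deg v B + T ≤ length Bs * T + t
    ∑deg-bad≤ t v (B ∷ Bs) (_ ∷ parts) (here bad) = begin
      deg v B + ∑[ B ∈ Bs ] deg v B + T ≤⟨ +-monoˡ-≤ T (+-mono-≤ (<⇒≤ (≰⇒> bad)) (∑deg≤ v Bs parts)) ⟩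
      t + length Bs * T + T             ≡⟨ arrange t (length Bs * T) T ⟩
      T + length Bs * T + t             ∎
      where
      open ≤-Reasoning
      arrange : ∀ a b c → a + b + c ≡ c + b + a
      arrange = solve-∀
    ∑deg-bad≤ t v (B ∷ Bs) ((_ , _ , refl) ∷ parts) (there bad) = begin
      deg v B + ∑[ B ∈ Bs ] deg v B + T   ≡⟨ +-assoc (deg v B) _ T ⟩
      deg v B + (∑[ B ∈ Bs ] deg v B + T) ≤⟨ +-mono-≤ (deg≤length v B) (∑deg-bad≤ t v Bs parts bad) ⟩
      T + (length Bs * T + t)             ≡⟨ +-assoc T _ t ⟨
      T + length Bs * T + t               ∎
      where open ≤-Reasoning

    highDegree-∑ : ∀ p q Bs → All (IsPart T S) Bs → All (HighDegree p q S) S →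
                   length Bs * (T * (2 * (p * length S))) ≤
                   2 * (q * (∑[ B ∈ Bs ] ∑[ b ∈ B ] deg b S)) + length Bs * (T * p)
    highDegree-∑ p q []       []                          high = z≤n
    highDegree-∑ p q (B ∷ Bs) ((B⊆S , _ , refl) ∷ parts) high = begin
      T * (2 * (p * length S)) + rest
        ≤⟨ +-mono-≤ part (highDegree-∑ p q Bs parts high) ⟩
      (2 * (q * (∑[ b ∈ B ] deg b S)) + T * p) + (2 * (q * tail) + length Bs * (T * p))
        ≡⟨ arrange q (∑[ b ∈ B ] deg b S) (T * p) tail (length Bs * (T * p)) ⟩
      2 * (q * (∑[ b ∈ B ] deg b S + tail)) + (T * p + length Bs * (T * p)) ∎
      where
      open ≤-Reasoning
      tail = ∑[ B ∈ Bs ] ∑[ b ∈ B ] deg b S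
      rest = length Bs * (T * (2 * (p * length S)))
      arrange : ∀ q x a y b → 2 * (q * x) + a + (2 * (q * y) + b) ≡ 2 * (q * (x + y)) + (a + b)
      arrange = solve-∀
      part : T * (2 * (p * length S)) ≤ 2 * (q * (∑[ b ∈ B ] deg b S)) + T * p
      part = begin
        length B * (2 * (p * length S))             ≡⟨ ∑-const B _ ⟨
        (∑[ _ ∈ B ] 2 * (p * length S))             ≤⟨ ∑-mono B (λ b∈B → All.lookup high (B⊆S b∈B)) ⟩
        ∑[ b ∈ B ] (2 * (q * deg b S) + p)          ≡⟨ ∑-+ B _ _ ⟩
        ∑[ b ∈ B ] 2 * (q * deg b S) + ∑[ _ ∈ B ] p ≡⟨ cong₂ _+_ (trans (∑-* B 2 _) (cong (2 *_) (∑-* B q _))) (∑-const B p) ⟩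
        2 * (q * (∑[ b ∈ B ] deg b S)) + length B * p ∎

  module _ (t : ℕ) (Bs : List (List V)) where

    good? : ∀ v → Dec (All (λ B → t ≤ deg v B) Bs)
    good? v = All.all? (λ B → t ≤? deg v B) Bs

    good : V → Bool
    good v = does (good? v)

    ∑deg+T≤ : ∀ {T S} v → All (IsPart T S) Bs →
              ∑[ B ∈ Bs ] deg v B + T ≤ length Bs * T + t + T * 𝟙 (good v)
    ∑deg+T≤ {T} v parts with good? v
    ... | yes _ = +-mono-≤ (≤-trans (∑deg≤ v Bs parts) (m≤m+n _ t)) (≤-reflexive (sym (*-identityʳ T)))
    ... | no ¬g = ≤-trans (∑deg-bad≤ t v Bs parts (¬All⇒Any¬ (λ B → t ≤? deg v B) Bs ¬g)) (m≤m+n _ _)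

    -- The edges between the parts and `S` are counted from the side of `S`, where a good vertex is
    -- allowed `T` more than a bad one. `highDegree-∑` counts the same edges from the side of the
    -- parts.
    goodVertices : ∀ {T S} → All (IsPart T S) Bs →
      ∑[ B ∈ Bs ] ∑[ b ∈ B ] deg b S + length S * T ≤
      length S * (length Bs * T + t) + T * length (filterᵇ good S)
    goodVertices {T} {S} parts = begin
      ∑[ B ∈ Bs ] ∑[ b ∈ B ] deg b S + length S * T
        ≡⟨ cong₂ _+_ (trans (∑-cong Bs λ B → deg-sym B S) (∑-swap Bs S _)) (sym (∑-const S T)) ⟩
      ∑[ v ∈ S ] ∑[ B ∈ Bs ] deg v B + ∑[ _ ∈ S ] T
        ≡⟨ ∑-+ S _ _ ⟨
      ∑[ v ∈ S ] (∑[ B ∈ Bs ] deg v B + T)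
        ≤⟨ ∑-mono S (λ {v} _ → ∑deg+T≤ v parts) ⟩
      ∑[ v ∈ S ] (length Bs * T + t + T * 𝟙 (good v))
        ≡⟨ ∑-+ S _ _ ⟩
      (∑[ _ ∈ S ] (length Bs * T + t)) + (∑[ v ∈ S ] T * 𝟙 (good v))
        ≡⟨ cong₂ _+_ (∑-const S _) (trans (∑-* S T _) (cong (T *_) (sym (length-filterᵇ good S)))) ⟩
      length S * (length Bs * T + t) + T * length (filterᵇ good S) ∎
      where open ≤-Reasoning

  many-good : ∀ p q s t N X g → .{{NonZero q}} → .{{NonZero t}} → q * s + 1 ≤ p * s + q →
    X + N * (2 * q * t) ≤ N * (s * (2 * q * t) + t) + 2 * q * t * g →
    s * (2 * q * t * (2 * (p * N))) ≤ 2 * (q * X) + s * (2 * q * t * p) →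
    N ≤ p * s + 2 * q * g
  many-good p q s t N X g ratio upper lower = *-cancelˡ-≤ (2 * q * t) {{m*n≢0 (2 * q) t {{m*n≢0 2 q}}}}
    (+-compensate-≤ {z = 0}
      (+-mono-≤ (+-mono-≤ (*-monoʳ-≤ (2 * q) upper) lower) (*-monoʳ-≤ (2 * N * (2 * q * t)) ratio))
      (identity p q s t N X g))
    where
    identity : ∀ p q s t N X g →
      2 * q * t * (p * s + 2 * q * g) +
        (2 * q * (X + N * (2 * q * t)) + s * (2 * q * t * (2 * (p * N))) + 2 * N * (2 * q * t) * (q * s + 1)) ≡
      2 * q * t * N +
        (2 * q * (N * (s * (2 * q * t) + t) + 2 * q * t * g) + (2 * (q * X) + s * (2 * q * t * p)) +
         2 * N * (2 * q * t) * (p * s + q)) + 0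
    identity = solve-∀

  enoughGood : ∀ p q t Bs S → .{{NonZero q}} → .{{NonZero t}} → q * length Bs + 1 ≤ p * length Bs + q →
    All (HighDegree p q S) S → All (IsPart (2 * q * t) S) Bs → ∀ g →
    p * length Bs + 2 * q * g ≤ length S → g ≤ length (filterᵇ (good t Bs) S)
  enoughGood p q t Bs S ratio high parts g large =
    *-cancelˡ-≤ (2 * q) {{m*n≢0 2 q}} (+-cancelˡ-≤ (p * length Bs) _ _ (≤-trans large
      (many-good p q (length Bs) t (length S) _ _ ratio (goodVertices t Bs parts) (highDegree-∑ p q Bs parts high))))

  -- All vertices of W have the same neighbours in ⋃ Bs as w, so they can be joined to those neighbours.
  addPart : ∀ {T S} t Bs W w → w ∈ W → W ⊆ filterᵇ (good t Bs) S → Unique W → t ≤ length W →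
    (∀ {b} → b ∈ concat Bs → ∀ {x y} → x ∈ W → y ∈ W → (b ~ x) ≡ (b ~ y)) →
    All (IsPart T S) Bs → AllPairs Complete Bs → ∃ (IsBlowup (suc (length Bs)) t S)
  addPart {T} {S} t Bs W w w∈W W⊆ uW t≤W hom parts complete =
    take t W ∷ map shrink Bs ,
    cong suc (length-map shrink Bs) ,
    (S⊇W , Unique.take⁺ t uW , length-take-≤ t W t≤W) ∷ All.map⁺ (All.tabulate shrunk) ,
    All.map⁺ (All.tabulate joined) ∷
      AllPairs.map⁺ (AllPairs.map (λ c {_} {_} x∈ y∈ → c (shrink⊆ x∈) (shrink⊆ y∈)) complete)
    where
    shrink : List V → List V
    shrink B = take t (filterᵇ (w ~_) B)

    shrink-~ : ∀ {B x} → x ∈ shrink B → x ∈ B × (w ~ x) ≡ true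
    shrink-~ {B} x∈ = ∈-filterᵇ⁻ (w ~_) B (take-⊆ t (filterᵇ (w ~_) B) x∈)

    shrink⊆ : ∀ {B} → shrink B ⊆ B
    shrink⊆ x∈ = proj₁ (shrink-~ x∈)

    S⊇W : take t W ⊆ S
    S⊇W x∈ = proj₁ (∈-filterᵇ⁻ (good t Bs) S (W⊆ (take-⊆ t W x∈)))

    w-good : All (λ B → t ≤ deg w B) Bs
    w-good = dec-true⁻¹ (good? t Bs w) (proj₂ (∈-filterᵇ⁻ (good t Bs) S (W⊆ w∈W)))
      where
      dec-true⁻¹ : ∀ {P : Set} (d : Dec P) → does d ≡ true → P
      dec-true⁻¹ (yes p) _ = p

    shrunk : ∀ {B} → B ∈ Bs → IsPart t S (shrink B)
    shrunk {B} B∈ with B⊆S , uB , _ ← All.lookup parts B∈ =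
      B⊆S ∘ shrink⊆ , Unique.take⁺ t (Unique.filter⁺ (T? ∘ (w ~_)) uB) ,
      length-take-≤ t (filterᵇ (w ~_) B) (subst (t ≤_) (sym (length-filterᵇ (w ~_) B)) (All.lookup w-good B∈))

    joined : ∀ {B} → B ∈ Bs → Complete (take t W) (shrink B)
    joined {B} B∈ {x} {y} x∈ y∈ with y∈B , wy ← shrink-~ {B} y∈ = begin
      (x ~ y) ≡⟨ ~-sym x y ⟩
      (y ~ x) ≡⟨ hom (∈-concat⁺′ y∈B B∈) (take-⊆ t W x∈) w∈W ⟩
      (y ~ w) ≡⟨ ~-sym y w ⟩
      (w ~ y) ≡⟨ wy ⟩
      true    ∎
      where open ≡-Reasoning

  -- The s old parts have s · 2qt vertices together, so there are at most 2 ^ (s · 2qt)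
  -- neighbourhood patterns on them, and t · 2 ^ (s · 2qt) good vertices contain t with a common
  -- pattern.
  extend : ∀ p q s t → .{{NonZero q}} → .{{NonZero t}} → q * s + 1 ≤ p * s + q →
    ∀ S → Unique S → All (HighDegree p q S) S →
    p * s + 2 * q * (t * 2 ^ (s * (2 * q * t))) ≤ length S →
    ∃ (IsBlowup s (2 * q * t) S) → ∃ (IsBlowup (suc s) t S)
  extend p q _ t ratio S uS high large (Bs , refl , parts , complete) =
    fromHomogeneous (homogeneous _~_ (concat Bs) goods t (Unique.filter⁺ (T? ∘ good t Bs) uS)
      (subst (λ l → t * 2 ^ l ≤ length goods) (sym (length-concat Bs parts))
        (enoughGood p q t Bs S ratio high parts _ large)))
    where
    goods = filterᵇ (good t Bs) S
    fromHomogeneous : HomogeneousSubset _~_ (concat Bs) goods t →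
      ∃ (IsBlowup (suc (length Bs)) t S)
    fromHomogeneous ([] , _ , _ , t≤0 , _) = contradiction t≤0 (<⇒≱ (>-nonZero⁻¹ t))
    fromHomogeneous (w ∷ W , W⊆ , uW , t≤W , hom) =
      addPart t Bs (w ∷ W) w (here refl) W⊆ uW t≤W hom parts complete

-- The size threshold does not depend on the graph.
blowupSize : ℕ → ℕ → ℕ → ℕ → ℕ
blowupSize p q zero    t = 0
blowupSize p q (suc s) t = p * s + 2 * q * (t * 2 ^ (s * (2 * q * t))) + blowupSize p q s (2 * q * t)

-- To obtain `suc s` parts of size t, s parts of size 2qt are requested first, so t must vary in the
-- recursion. The step out of s parts uses `ratio` at s; hence s ≤ r is enough to reach r + 1 parts.
blowup : ∀ {V : Set} (Γ : SimpleGraph V) →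
  ∀ p q r → .{{_ : NonZero q}} → (∀ s → s ≤ r → q * s + 1 ≤ p * s + q) →
  ∀ s t → .{{NonZero t}} → s ≤ suc r → 
  ∀ S → Unique S → All (HighDegree Γ p q S) S → blowupSize p q s t ≤ length S →
  ∃ (IsBlowup Γ s t S)
blowup Γ p q r ratio zero t s≤ S uS high large = [] , refl , [] , []
blowup Γ p q r ratio (suc s) t (s≤s s≤r) S uS high large =
  extend Γ p q s t (ratio s s≤r) S uS high (≤-trans (m≤m+n _ _) large)
    (blowup Γ p q r ratio s (2 * q * t) {{m*n≢0 (2 * q) t {{m*n≢0 2 q}}}}
      (m≤n⇒m≤1+n s≤r) S uS high (≤-trans (m≤n+m _ _) large))

-- The graph of 2-edges and the embedding of a coloured hypergraph into a blow-up.

adj-sym : ∀ {n} (G : Graph12 n) i j → adj G i j ≡ adj G j i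
adj-sym G i j = ∨-comm ((toℕ i <ᵇ toℕ j) ∧ two G i j) ((toℕ j <ᵇ toℕ i) ∧ two G j i)

n<ᵇn : ∀ n → (n <ᵇ n) ≡ false
n<ᵇn zero    = refl
n<ᵇn (suc n) = n<ᵇn n

adj-irrefl : ∀ {n} (G : Graph12 n) i → adj G i i ≡ false
adj-irrefl G i rewrite n<ᵇn (toℕ i) = refl

graph : ∀ {n} → Graph12 n → SimpleGraph (Fin n)
graph G = record { _~_ = adj G ; ~-sym = adj-sym G ; ~-irrefl = adj-irrefl G }

AllPairs-lookup : ∀ {A : Set} {R : A → A → Set} → (∀ {x y} → R x y → R y x) →
                  ∀ {xs} → AllPairs R xs → ∀ i j → i ≢ j → R (lookup xs i) (lookup xs j)
AllPairs-lookup R-sym (x ∷ xs) zero    zero    i≢j = contradiction refl i≢j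
AllPairs-lookup R-sym (x ∷ xs) zero    (suc j) i≢j = All.lookup x (∈-lookup j)
AllPairs-lookup R-sym (x ∷ xs) (suc i) zero    i≢j = R-sym (All.lookup x (∈-lookup i))
AllPairs-lookup R-sym (x ∷ xs) (suc i) (suc j) i≢j = AllPairs-lookup R-sym xs i j (i≢j ∘ cong suc)

Unique-lookup-injective : ∀ {A : Set} {xs : List A} → Unique xs → Injective _≡_ _≡_ (lookup xs)
Unique-lookup-injective uxs {i} {j} eq =
  decidable-stable (i ≟ᶠ j) λ i≢j → AllPairs-lookup (λ x≢y → x≢y ∘ sym) uxs i j i≢j eq

module _ {n} (G : Graph12 n) where

  -- Vertex v goes to position `toℕ v` of the part of its colour, which exists because parts have at
  -- least m elements. Vertices of one colour get different positions; vertices of different colours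
  -- get adjacent, hence distinct, images.
  blowup-contains : ∀ {m χ t S Bs} (H : Graph12 m) → Colourable H χ → m ≤ t →
                    All (λ v → one G v ≡ true) S → IsBlowup (graph G) χ t S Bs → Contains G H
  blowup-contains {m} {t = t} {S} {Bs} H (c , proper) m≤t ones (refl , parts , complete) =
    φ , φ-injective , (λ v _ → All.lookup ones (proj₁ (part (c v)) (pick∈ (c v) v))) ,
    λ i j ij → joined i j (proper i j ij)
    where
    part : ∀ i → IsPart (graph G) t S (lookup Bs i)
    part i = All.lookup parts (∈-lookup i)

    bound : ∀ i (v : Fin m) → toℕ v < length (lookup Bs i)
    bound i v = subst (toℕ v <_) (sym (proj₂ (proj₂ (part i)))) (≤-trans (toℕ<n v) m≤t)

    pick : Fin (length Bs) → Fin m → Fin n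
    pick i v = lookup (lookup Bs i) (fromℕ< (bound i v))

    pick∈ : ∀ i v → pick i v ∈ lookup Bs i
    pick∈ i v = ∈-lookup (fromℕ< (bound i v))

    φ : Fin m → Fin n
    φ v = pick (c v) v

    joined : ∀ i j → c i ≢ c j → adj G (φ i) (φ j) ≡ true
    joined i j ci≢cj =
      AllPairs-lookup {R = Complete (graph G)}
        (λ com {x} {y} x∈ y∈ → trans (adj-sym G x y) (com y∈ x∈)) complete (c i) (c j) ci≢cj
        (pick∈ (c i) i) (pick∈ (c j) j)

    φ-injective : Injective _≡_ _≡_ φ
    φ-injective {i} {j} φi≡φj with c i ≟ᶠ c j
    ... | no ci≢cj = contradiction
      (trans (sym (joined i j ci≢cj)) (trans (cong (λ x → adj G x (φ j)) φi≡φj) (adj-irrefl G (φ j)))) λ ()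
    ... | yes ci≡cj = toℕ-injective (fromℕ<-injective _ _ (bound (c j) i) (bound (c j) j)
      (Unique-lookup-injective (proj₁ (proj₂ (part (c j))))
        (trans (cong (λ z → pick z i) (sym ci≡cj)) φi≡φj)))

-- Edge counts as degree sums, in the whole graph and in a filtered part.

∑-cartesianProduct : ∀ {A B : Set} (xs : List A) (ys : List B) (f : A × B → ℕ) →
                     ∑ (cartesianProduct xs ys) f ≡ ∑[ x ∈ xs ] ∑[ y ∈ ys ] f (x , y)
∑-cartesianProduct []       ys f = refl
∑-cartesianProduct (x ∷ xs) ys f = trans (∑-++ (map (x ,_) ys) (cartesianProduct xs ys) f)
  (cong₂ _+_ (∑-map ys) (∑-cartesianProduct xs ys f))
  where
  ∑-map : ∀ ys → ∑ (map (x ,_) ys) f ≡ ∑[ y ∈ ys ] f (x , y)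
  ∑-map []       = refl
  ∑-map (y ∷ ys) = cong (_ +_) (∑-map ys)

length-allFin : ∀ n → length (allFin n) ≡ n
length-allFin n = length-tabulate {n = n} (λ i → i)

module _ {n} (G : Graph12 n) where

  private
    Γ = graph G

  edges2-vol : 2 * edges2 G ≡ vol Γ (allFin n)
  edges2-vol = begin
    2 * edges2 G                                             ≡⟨ cong (edges2 G +_) (+-identityʳ (edges2 G)) ⟩
    edges2 G + edges2 G                                      ≡⟨ cong₂ _+_ edges2-∑ (trans edges2-∑ (∑-swap (allFin n) (allFin n) _)) ⟩
    ∑[ i ∈ allFin n ] ∑[ j ∈ allFin n ] 𝟙 (arc i j) +
    ∑[ i ∈ allFin n ] ∑[ j ∈ allFin n ] 𝟙 (arc j i)          ≡⟨ ∑-+ (allFin n) _ _ ⟨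
    ∑[ i ∈ allFin n ] (∑[ j ∈ allFin n ] 𝟙 (arc i j) +
                       ∑[ j ∈ allFin n ] 𝟙 (arc j i))        ≡⟨ ∑-cong (allFin n) (λ i → trans (sym (∑-+ (allFin n) _ _)) (∑-cong (allFin n) (arcs i))) ⟩
    vol Γ (allFin n)                                         ∎
    where
    open ≡-Reasoning
    arc : Fin n → Fin n → Bool
    arc i j = (toℕ i <ᵇ toℕ j) ∧ two G i j

    edges2-∑ : edges2 G ≡ ∑[ i ∈ allFin n ] ∑[ j ∈ allFin n ] 𝟙 (arc i j)
    edges2-∑ = trans (length-filterᵇ _ (cartesianProduct (allFin n) (allFin n))) (∑-cartesianProduct (allFin n) (allFin n) _)

    disjoint : ∀ a b x y → 𝟙 ((a <ᵇ b) ∧ x) + 𝟙 ((b <ᵇ a) ∧ y) ≡ 𝟙 ((a <ᵇ b) ∧ x ∨ (b <ᵇ a) ∧ y)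
    disjoint zero    zero    x y = refl
    disjoint zero    (suc b) x y with x
    ... | true  = refl
    ... | false = refl
    disjoint (suc a) zero    x y = refl
    disjoint (suc a) (suc b) x y = disjoint a b x y

    arcs : ∀ i j → 𝟙 (arc i j) + 𝟙 (arc j i) ≡ 𝟙 (adj G i j)
    arcs i j = disjoint (toℕ i) (toℕ j) (two G i j) (two G j i)

  -- Only the pairs that do not lie inside the filtered part can be lost.
  vol-filterᵇ : ∀ p S → vol Γ S + length (filterᵇ p S) * length (filterᵇ p S) ≤
                        vol Γ (filterᵇ p S) + length S * length S
  vol-filterᵇ p S = begin
    vol Γ S + length X * length X
      ≡⟨ cong (vol Γ S +_) (trans (sym (∑-const X (length X))) (∑-filterᵇ p _ S)) ⟩
    vol Γ S + ∑[ v ∈ S ] 𝟙 (p v) * length X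
      ≡⟨ ∑-+ S _ _ ⟨
    ∑[ v ∈ S ] (degree v S + 𝟙 (p v) * length X)
      ≤⟨ ∑-mono S (λ {v} _ → row v) ⟩
    ∑[ v ∈ S ] (𝟙 (p v) * degree v X + length S)
      ≡⟨ ∑-+ S _ _ ⟩
    ∑[ v ∈ S ] 𝟙 (p v) * degree v X + ∑[ _ ∈ S ] length S
      ≡⟨ cong₂ _+_ (sym (∑-filterᵇ p _ S)) (∑-const S (length S)) ⟩
    vol Γ X + length S * length S ∎
    where
    open ≤-Reasoning
    X = filterᵇ p S
    degree = deg Γ
    entry : ∀ a b → 𝟙 a + 𝟙 b ≤ 𝟙 b * 𝟙 a + 1
    entry true  true  = ≤-refl
    entry true  false = ≤-refl
    entry false true  = ≤-refl
    entry false false = z≤n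
    row : ∀ v → degree v S + 𝟙 (p v) * length X ≤ 𝟙 (p v) * degree v X + length S
    row v with p v
    ... | false = ≤-trans (≤-reflexive (+-identityʳ _)) (deg≤length Γ v S)
    ... | true  = begin
      degree v S + 1 * length X
        ≡⟨ cong (degree v S +_) (trans (*-identityˡ (length X)) (length-filterᵇ p S)) ⟩
      degree v S + ∑[ w ∈ S ] 𝟙 (p w)
        ≡⟨ ∑-+ S _ _ ⟨
      ∑[ w ∈ S ] (𝟙 (adj G v w) + 𝟙 (p w))
        ≤⟨ ∑-mono S (λ {w} _ → entry (adj G v w) (p w)) ⟩
      ∑[ w ∈ S ] (𝟙 (p w) * 𝟙 (adj G v w) + 1)
        ≡⟨ ∑-+ S _ _ ⟩
      ∑[ w ∈ S ] 𝟙 (p w) * 𝟙 (adj G v w) + ∑[ _ ∈ S ] 1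
        ≡⟨ cong₂ _+_ (trans (sym (∑-filterᵇ p _ S)) (sym (*-identityˡ _))) (trans (∑-const S 1) (*-identityʳ _)) ⟩
      1 * degree v X + length S ∎

-- Clearing denominators in the Lubell function.

2*nC2 : ∀ n → 2 * (suc n C 2) ≡ suc n * n
2*nC2 zero    = refl
2*nC2 (suc n) = begin
  2 * (suc (suc n) C 2)          ≡⟨ cong (2 *_) (nCk+nC[k+1]≡[n+1]C[k+1] (suc n) 1) ⟨
  2 * (suc n C 1 + suc n C 2)    ≡⟨ *-distribˡ-+ 2 (suc n C 1) (suc n C 2) ⟩
  2 * (suc n C 1) + 2 * (suc n C 2) ≡⟨ cong₂ (λ a b → 2 * a + b) (nC1≡n (suc n)) (2*nC2 n) ⟩
  2 * suc n + suc n * n          ≡⟨ arrange n ⟩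
  suc (suc n) * suc n            ∎
  where
  open ≡-Reasoning
  arrange : ∀ n → 2 * (1 + n) + (1 + n) * n ≡ (2 + n) * (1 + n)
  arrange = solve-∀

toℚᵘ-frac : ∀ a b → toℚᵘ (frac a (suc b)) ℚᵘ.≃ mkℚᵘ (ℤ.+ a) b
toℚᵘ-frac a b = ℚ.toℚᵘ-fromℚᵘ (mkℚᵘ (ℤ.+ a) b)

frac-+ : ∀ a b c d → .{{NonZero b}} → .{{NonZero d}} → frac a b ℚ.+ frac c d ≡ frac (a * d + c * b) (b * d)
frac-+ a (suc b) c (suc d) = ℚ.toℚᵘ-injective (begin-equality
  toℚᵘ (frac a (suc b) ℚ.+ frac c (suc d))           ≃⟨ ℚ.toℚᵘ-homo-+ (frac a (suc b)) (frac c (suc d)) ⟩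
  toℚᵘ (frac a (suc b)) ℚᵘ.+ toℚᵘ (frac c (suc d))   ≃⟨ ℚᵘ.+-cong (toℚᵘ-frac a b) (toℚᵘ-frac c d) ⟩
  mkℚᵘ (ℤ.+ a ℤ.* ℤ.+ suc d ℤ.+ ℤ.+ c ℤ.* ℤ.+ suc b) _       ≡⟨ cong (λ z → mkℚᵘ z _) (cong₂ ℤ._+_ (ℤ.pos-* a (suc d)) (ℤ.pos-* c (suc b))) ⟨
  mkℚᵘ (ℤ.+ (a * suc d + c * suc b)) _                 ≃⟨ toℚᵘ-frac (a * suc d + c * suc b) (d + b * suc d) ⟨
  toℚᵘ (frac (a * suc d + c * suc b) (suc b * suc d)) ∎)
  where open ℚᵘ.≤-Reasoning

frac-≤ : ∀ a b c d → .{{NonZero b}} → .{{NonZero d}} → a * d ≤ c * b → frac a b ℚ.≤ frac c d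
frac-≤ a (suc b) c (suc d) ad≤cb = ℚ.toℚᵘ-cancel-≤
  (ℚᵘ.≤-respˡ-≃ (ℚᵘ.≃-sym (toℚᵘ-frac a b)) (ℚᵘ.≤-respʳ-≃ (ℚᵘ.≃-sym (toℚᵘ-frac c d))
    (*≤* (subst₂ ℤ._≤_ (ℤ.pos-* a (suc d)) (ℤ.pos-* c (suc b)) (ℤ.+≤+ ad≤cb)))))

frac-≤⁻ : ∀ a b c d → .{{NonZero b}} → .{{NonZero d}} → frac a b ℚ.≤ frac c d → a * d ≤ c * b
frac-≤⁻ a (suc b) c (suc d) le = ℤ.drop‿+≤+
  (subst₂ ℤ._≤_ (sym (ℤ.pos-* a (suc d))) (sym (ℤ.pos-* c (suc b)))
    (ℚᵘ.drop-*≤* (ℚᵘ.≤-respˡ-≃ (toℚᵘ-frac a b) (ℚᵘ.≤-respʳ-≃ (toℚᵘ-frac c d) (ℚ.toℚᵘ-mono-≤ le)))))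

-- The denominator of ε serves, since a positive numerator is at least 1.
archimedean : ∀ ε → 0ℚ ℚ.< ε → ∃ λ k → frac 1 (suc k) ℚ.≤ ε
archimedean ε@(mkℚ (ℤ.+ zero)  d _) 0<ε = contradiction 0<ε (ℚ.<-irrefl (ℚ.toℚᵘ-injective (ℚᵘ.*≡* refl)))
archimedean ε@(mkℚ (ℤ.+ suc a) d _) 0<ε = d ,
  ℚ.toℚᵘ-cancel-≤ (ℚᵘ.≤-respˡ-≃ (ℚᵘ.≃-sym (toℚᵘ-frac 1 d)) (*≤* (ℤ.+≤+ (*-monoˡ-≤ (suc d) {1} {suc a} (s≤s z≤n)))))
archimedean ε@(mkℚ -[1+ a ] d _) 0<ε with ℚ.positive 0<ε
... | ()

module _ (r k n′ c e₁ e₂ : ℕ) .{{_ : NonZero r}} .{{_ : NonZero k}} .{{_ : NonZero c}}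
         (2c≡ : 2 * c ≡ suc n′ * n′) where

  private
    n = suc n′
    instance
      nc≢0 : NonZero (n * c)
      nc≢0 = m*n≢0 n c
      ncr≢0 : NonZero (n * c * r)
      ncr≢0 = m*n≢0 (n * c) r
      ncrk≢0 : NonZero (n * c * r * k)
      ncrk≢0 = m*n≢0 (n * c * r) k
      1k≢0 : NonZero (1 * k)
      1k≢0 = m*n≢0 1 k

  -- The term 1/r stands on the right so that both sides are fractions of natural numbers. Adding
  -- the two densities gives the denominator n·c, while n·n′ = 2c would suffice; hence the doubling
  -- and the cancelled factor n.
  upper-clear : frac 2 1 ℚ.+ frac 1 k ℚ.≤ frac e₁ n ℚ.+ frac e₂ c ℚ.+ frac 1 r →
                (2 * k + 1) * r * (n * n′) ≤ k * r * (e₁ * n′ + 2 * e₂) + k * (n * n′)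
  upper-clear le = *-cancelˡ-≤ n (begin
    n * ((2 * k + 1) * r * (n * n′))
      ≡⟨ cong (λ x → n * ((2 * k + 1) * r * x)) 2c≡ ⟨
    n * ((2 * k + 1) * r * (2 * c))
      ≡⟨ lhs n k r c ⟩
    2 * ((2 * k + 1 * 1) * (n * c * r))
      ≤⟨ *-monoʳ-≤ 2 (frac-≤⁻ (2 * k + 1 * 1) (1 * k) ((e₁ * c + e₂ * n) * r + 1 * (n * c)) (n * c * r) (subst₂ ℚ._≤_
           (frac-+ 2 1 1 k) (trans (cong (ℚ._+ frac 1 r) (frac-+ e₁ n e₂ c)) (frac-+ (e₁ * c + e₂ * n) (n * c) 1 r)) le)) ⟩
    2 * (((e₁ * c + e₂ * n) * r + 1 * (n * c)) * (1 * k))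
      ≡⟨ middle n k r c e₁ e₂ ⟩
    k * r * (e₁ * (2 * c) + n * (2 * e₂)) + k * (n * (2 * c))
      ≡⟨ cong (λ x → k * r * (e₁ * x + n * (2 * e₂)) + k * (n * x)) 2c≡ ⟩
    k * r * (e₁ * (n * n′) + n * (2 * e₂)) + k * (n * (n * n′))
      ≡⟨ rhs n n′ k r e₁ e₂ ⟩
    n * (k * r * (e₁ * n′ + 2 * e₂) + k * (n * n′)) ∎)
    where
    open ≤-Reasoning
    lhs : ∀ n k r c → n * ((2 * k + 1) * r * (2 * c)) ≡ 2 * ((2 * k + 1 * 1) * (n * c * r))
    lhs = solve-∀
    middle : ∀ n k r c e₁ e₂ → 2 * (((e₁ * c + e₂ * n) * r + 1 * (n * c)) * (1 * k)) ≡
             k * r * (e₁ * (2 * c) + n * (2 * e₂)) + k * (n * (2 * c))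
    middle = solve-∀
    rhs : ∀ n n′ k r e₁ e₂ → k * r * (e₁ * (n * n′) + n * (2 * e₂)) + k * (n * (n * n′)) ≡
          n * (k * r * (e₁ * n′ + 2 * e₂) + k * (n * n′))
    rhs = solve-∀

  lower-clear : 2 * (n * n′) * r * k ≤ ((e₁ * n′ + 2 * e₂) * r + n * n′) * k + n * n′ * r →
                frac 2 1 ℚ.≤ frac e₁ n ℚ.+ frac e₂ c ℚ.+ frac 1 r ℚ.+ frac 1 k
  lower-clear le = subst (frac 2 1 ℚ.≤_)
    (sym (trans (cong (λ x → x ℚ.+ frac 1 r ℚ.+ frac 1 k) (frac-+ e₁ n e₂ c))
         (trans (cong (ℚ._+ frac 1 k) (frac-+ (e₁ * c + e₂ * n) (n * c) 1 r))
                (frac-+ ((e₁ * c + e₂ * n) * r + 1 * (n * c)) (n * c * r) 1 k))))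
    (frac-≤ 2 1 (((e₁ * c + e₂ * n) * r + 1 * (n * c)) * k + 1 * (n * c * r)) (n * c * r * k) (*-cancelˡ-≤ 2 (begin
      2 * (2 * (n * c * r * k))
        ≡⟨ lhs n c r k ⟩
      n * (2 * (2 * c) * r * k)
        ≡⟨ cong (λ x → n * (2 * x * r * k)) 2c≡ ⟩
      n * (2 * (n * n′) * r * k)
        ≤⟨ *-monoʳ-≤ n le ⟩
      n * (((e₁ * n′ + 2 * e₂) * r + n * n′) * k + n * n′ * r)
        ≡⟨ rhs n n′ k r e₁ e₂ ⟩
      ((e₁ * (n * n′) + 2 * e₂ * n) * r + n * (n * n′)) * k + n * (n * n′) * r
        ≡⟨ cong (λ x → ((e₁ * x + 2 * e₂ * n) * r + n * x) * k + n * x * r) 2c≡ ⟨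
      ((e₁ * (2 * c) + 2 * e₂ * n) * r + n * (2 * c)) * k + n * (2 * c) * r
        ≡⟨ middle n k r c e₁ e₂ ⟩
      2 * ((((e₁ * c + e₂ * n) * r + 1 * (n * c)) * k + 1 * (n * c * r)) * 1) ∎)))
    where
    open ≤-Reasoning
    lhs : ∀ n c r k → 2 * (2 * (n * c * r * k)) ≡ n * (2 * (2 * c) * r * k)
    lhs = solve-∀
    rhs : ∀ n n′ k r e₁ e₂ → n * (((e₁ * n′ + 2 * e₂) * r + n * n′) * k + n * n′ * r) ≡
          ((e₁ * (n * n′) + 2 * e₂ * n) * r + n * (n * n′)) * k + n * (n * n′) * r
    rhs = solve-∀
    middle : ∀ n k r c e₁ e₂ → ((e₁ * (2 * c) + 2 * e₂ * n) * r + n * (2 * c)) * k + n * (2 * c) * r ≡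
             2 * ((((e₁ * c + e₂ * n) * r + 1 * (n * c)) * k + 1 * (n * c * r)) * 1)
    middle = solve-∀

-- Upper bound: from a large Lubell value to a copy of the forbidden hypergraph.

-- e and x stand for twice the number of edges in the whole graph and in its part of a vertices.
dense-part : ∀ r′ k a n′ e x c → a ≤ suc n′ → let n = suc n′; r = 2 + r′ in
  (2 * k + 1) * r * (n * n′) ≤ k * r * (a * n′ + e) + k * (n * n′) →
  e + a * a ≤ x + n * n →
  (2 * k + 1) * r + c ≤ n →
  ((1 + r′) * k + 1) * (a * a) + c ≤ k * r * x
dense-part r′ k a n′ e x c a≤n lubell-large e≤x n-large =
  +-compensate-≤ {z = z} (+-mono-≤ (+-mono-≤ (*-monoʳ-≤ (k * r) e≤x) cleared) n²-large)
    (subst (λ n → Identity n) (m+[n∸m]≡n a≤n) (identity r′ k a b e x c))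
  where
  open ≤-Reasoning
  n = suc n′
  r = 2 + r′
  b = n ∸ a
  -- The exact slack, written in a and b = n - a: all its coefficients are nonnegative because r = 2
  -- + r′.
  z = r′ * (a * a) + (2 + 2 * r′ + k * r′) * (a * b) + (1 + r′) * (k + 1) * (b * b)

  cleared : (2 * k + 1) * r * (n * n) ≤ k * r * (a * n) + k * r * e + k * (n * n) + (2 * k + 1) * r * n
  cleared = begin
    (2 * k + 1) * r * (n * n)
      ≡⟨ lhs r k n′ ⟩
    (2 * k + 1) * r * (n * n′) + (2 * k + 1) * r * n
      ≤⟨ +-monoˡ-≤ _ lubell-large ⟩
    k * r * (a * n′ + e) + k * (n * n′) + (2 * k + 1) * r * n
      ≤⟨ m≤m+n _ (k * r * a + k * n) ⟩
    k * r * (a * n′ + e) + k * (n * n′) + (2 * k + 1) * r * n + (k * r * a + k * n)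
      ≡⟨ rhs r k n′ a e ⟩
    k * r * (a * n) + k * r * e + k * (n * n) + (2 * k + 1) * r * n ∎
    where
    lhs : ∀ r k n′ → (2 * k + 1) * r * ((1 + n′) * (1 + n′)) ≡
          (2 * k + 1) * r * ((1 + n′) * n′) + (2 * k + 1) * r * (1 + n′)
    lhs = solve-∀
    rhs : ∀ r k n′ a e →
          k * r * (a * n′ + e) + k * ((1 + n′) * n′) + (2 * k + 1) * r * (1 + n′) + (k * r * a + k * (1 + n′)) ≡
          k * r * (a * (1 + n′)) + k * r * e + k * ((1 + n′) * (1 + n′)) + (2 * k + 1) * r * (1 + n′)
    rhs = solve-∀

  -- One n² of the slack pays for `c` and for the error (2k + 1)rn made in replacing n·n′ by n².
  n²-large : (2 * k + 1) * r * n + c ≤ n * n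
  n²-large = begin
    (2 * k + 1) * r * n + c     ≤⟨ +-monoʳ-≤ ((2 * k + 1) * r * n) (m≤m*n c n) ⟩
    (2 * k + 1) * r * n + c * n ≡⟨ *-distribʳ-+ n ((2 * k + 1) * r) c ⟨
    ((2 * k + 1) * r + c) * n   ≤⟨ *-monoˡ-≤ n n-large ⟩
    n * n                       ∎

  Identity : ℕ → Set
  Identity n =
    k * r * x + (k * r * (e + a * a) + (2 * k + 1) * r * (n * n) + ((2 * k + 1) * r * n + c)) ≡
    ((1 + r′) * k + 1) * (a * a) + c +
      (k * r * (x + n * n) + (k * r * (a * n) + k * r * e + k * (n * n) + (2 * k + 1) * r * n) + n * n) + z

  identity : ∀ r′ k a b e x c →
    k * (2 + r′) * x + (k * (2 + r′) * (e + a * a) + (2 * k + 1) * (2 + r′) * ((a + b) * (a + b)) +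
      ((2 * k + 1) * (2 + r′) * (a + b) + c)) ≡
    ((1 + r′) * k + 1) * (a * a) + c +
      (k * (2 + r′) * (x + (a + b) * (a + b)) +
        (k * (2 + r′) * (a * (a + b)) + k * (2 + r′) * e + k * ((a + b) * (a + b)) + (2 * k + 1) * (2 + r′) * (a + b)) +
        (a + b) * (a + b)) +
      (r′ * (a * a) + (2 + 2 * r′ + k * r′) * (a * b) + (1 + r′) * (k + 1) * (b * b))
  identity = solve-∀

-- Since q - p = k - 1, this amounts to (k - 1)s + 1 ≤ kr. For s ≥ 1 it follows from ks ≤ kr; for s
-- = 0 it is the positivity of q.
degree-ratio : ∀ r′ k s → .{{NonZero k}} → s ≤ 2 + r′ →
               k * (2 + r′) * s + 1 ≤ ((1 + r′) * k + 1) * s + k * (2 + r′)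
degree-ratio r′ k@(suc _) zero _ = begin
  k * (2 + r′) * 0 + 1                        ≡⟨ cong (_+ 1) (*-zeroʳ (k * (2 + r′))) ⟩
  1                                           ≤⟨ s≤s z≤n ⟩
  k * (2 + r′)                                ≤⟨ m≤n+m _ (((1 + r′) * k + 1) * 0) ⟩
  ((1 + r′) * k + 1) * 0 + k * (2 + r′)       ∎
  where open ≤-Reasoning
degree-ratio r′ k (suc s) s≤r = +-compensate-≤ {z = s} (*-monoʳ-≤ k s≤r) (identity r′ k s)
  where
  identity : ∀ r′ k s → ((1 + r′) * k + 1) * (1 + s) + k * (2 + r′) + k * (1 + s) ≡
             k * (2 + r′) * (1 + s) + 1 + k * (2 + r′) + s
  identity = solve-∀

-- The 2 makes n C 2 nonzero, so that `frac` is a true quotient. The term (2k + 1)r absorbs the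
-- lower-order error, and the surplus q·M² forces a final set of at least M vertices, enough for the
-- blow-up.
upperThreshold : ℕ → ℕ → ℕ → ℕ
upperThreshold r′ k t = let r = 2 + r′; q = k * r; M = blowupSize ((1 + r′) * k + 1) q (suc r) t in
  2 + ((2 * k + 1) * r + q * (M * M))

square-cancel-≤ : ∀ m n → m * m ≤ n * n → m ≤ n
square-cancel-≤ m n m²≤n² with m ≤? n
... | yes m≤n = m≤n
... | no  m≰n = contradiction m²≤n² (<⇒≱ (*-mono-< (≰⇒> m≰n) (≰⇒> m≰n)))

nC2≢0 : ∀ n → NonZero (suc (suc n) C 2)
nC2≢0 n = >-nonZero (*-cancelˡ-< 2 0 _ (subst (0 <_) (sym (2*nC2 (suc n))) (s≤s z≤n)))

upper : ∀ {m} (H : Graph12 m) r′ k → .{{NonZero k}} → Colourable H (3 + r′) →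
  ∀ n → upperThreshold r′ k (suc m) ≤ n → ∀ (G : Graph12 n) →
  frac 2 1 ℚ.+ frac 1 k ℚ.≤ lubell G ℚ.+ frac 1 (2 + r′) → Contains G H
upper {m} H r′ k colouring (suc n′@(suc n″)) n-large@(s≤s (s≤s _)) G lubell-large =
  embed (minDegreeSubset (graph G) p q c₀ (length X) X refl
    (Unique.filter⁺ (T? ∘ one G) (Unique.allFin⁺ n)) dense)
  where
  n r p q M c₀ : ℕ
  n = suc n′
  r = 2 + r′
  p = (1 + r′) * k + 1
  q = k * r
  M = blowupSize p q (suc r) (suc m)
  c₀ = q * (M * M)
  X = filterᵇ (one G) (allFin n)
  instance
    q≢0 : NonZero q
    q≢0 = m*n≢0 k r

  vol≤ : 2 * edges2 G + length X * length X ≤ vol (graph G) X + n * n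
  vol≤ = subst₂ (λ e l → e + length X * length X ≤ vol (graph G) X + l * l)
    (sym (edges2-vol G)) (length-allFin n) (vol-filterᵇ G (one G) (allFin n))

  a≤n : length X ≤ n
  a≤n = subst (length X ≤_) (length-allFin n) (length-filter (T? ∘ one G) (allFin n))

  cleared : (2 * k + 1) * r * (n * n′) ≤ k * r * (length X * n′ + 2 * edges2 G) + k * (n * n′)
  cleared = upper-clear r k n′ (n C 2) (length X) (edges2 G) {{it}} {{it}} {{nC2≢0 n″}} (2*nC2 n′)
    (subst (λ c → frac 2 1 ℚ.+ frac 1 k ℚ.≤ frac (edges1 G) c ℚ.+ frac (edges2 G) (n C 2) ℚ.+ frac 1 r)
      (nC1≡n n) lubell-large)

  dense : p * (length X * length X) + c₀ ≤ q * vol (graph G) X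
  dense = dense-part r′ k (length X) n′ (2 * edges2 G) (vol (graph G) X) c₀ a≤n cleared vol≤
    (≤-trans (m≤n+m ((2 * k + 1) * r + c₀) 2) n-large)

  embed : (∃ λ S → S ⊆ X × Unique S × c₀ ≤ q * (length S * length S) × All (HighDegree (graph G) p q S) S) →
          Contains G H
  embed (S , S⊆X , uS , S-large , high) =
    -- Parts of size `suc m` rather than m keep the part size nonzero even for m = 0.
    blowup-contains G H colouring (n≤1+n m)
      (All.tabulate λ v∈S → proj₂ (∈-filterᵇ⁻ (one G) (allFin n) (S⊆X v∈S)))
      (proj₂ (blowup (graph G) p q r (λ s → degree-ratio r′ k s) (suc r) (suc m) ≤-refl S uS high
        (square-cancel-≤ M (length S) (*-cancelˡ-≤ q S-large))))

-- Lower bound: residue classes and the Turán graph.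

∑< : ℕ → (ℕ → ℕ) → ℕ
∑< zero    f = 0
∑< (suc n) f = f 0 + ∑< n (f ∘ suc)

∑-tabulate : ∀ {A : Set} n (g : Fin n → A) (h : A → ℕ) f → (∀ i → h (g i) ≡ f (toℕ i)) →
             ∑ (tabulate g) h ≡ ∑< n f
∑-tabulate zero    g h f eq = refl
∑-tabulate (suc n) g h f eq = cong₂ _+_ (eq zero) (∑-tabulate n (g ∘ suc) h (f ∘ suc) (eq ∘ suc))

∑<-cong : ∀ n {f g} → (∀ i → i < n → f i ≡ g i) → ∑< n f ≡ ∑< n g
∑<-cong zero    eq = refl
∑<-cong (suc n) eq = cong₂ _+_ (eq 0 (s≤s z≤n)) (∑<-cong n λ i i<n → eq (suc i) (s≤s i<n))

∑<-+ : ∀ m n f → ∑< (m + n) f ≡ ∑< m f + ∑< n (λ i → f (m + i))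
∑<-+ zero    n f = refl
∑<-+ (suc m) n f = trans (cong (f 0 +_) (∑<-+ m n (f ∘ suc))) (sym (+-assoc (f 0) _ _))

∑<-monoˡ : ∀ {m n} f → m ≤ n → ∑< m f ≤ ∑< n f
∑<-monoˡ f z≤n       = z≤n
∑<-monoˡ f (s≤s m≤n) = +-monoʳ-≤ (f 0) (∑<-monoˡ (f ∘ suc) m≤n)

∑<-zero : ∀ n → ∑< n (λ _ → 0) ≡ 0
∑<-zero zero    = refl
∑<-zero (suc n) = ∑<-zero n

∑<-≡ᵇ : ∀ c n → ∑< n (λ i → 𝟙 (c ≡ᵇ i)) ≤ 1
∑<-≡ᵇ c       zero    = z≤n
∑<-≡ᵇ zero    (suc n) = s≤s (≤-reflexive (∑<-zero n))
∑<-≡ᵇ (suc c) (suc n) = ∑<-≡ᵇ c n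

residues : ∀ r → .{{_ : NonZero r}} → ∀ c q → ∑< (q * r) (λ i → 𝟙 (c ≡ᵇ i % r)) ≤ q
residues r c zero    = z≤n
residues r c (suc q) = begin
  ∑< (r + q * r) f                          ≡⟨ ∑<-+ r (q * r) f ⟩
  ∑< r f + ∑< (q * r) (λ i → f (r + i))     ≡⟨ cong₂ _+_ (∑<-cong r λ i i<r → cong (λ x → 𝟙 (c ≡ᵇ x)) (m<n⇒m%n≡m i<r))
                                                 (∑<-cong (q * r) λ i _ → cong (λ x → 𝟙 (c ≡ᵇ x))
                                                   (trans (cong (_% r) (+-comm r i)) ([m+n]%n≡m%n i r))) ⟩
  ∑< r (λ i → 𝟙 (c ≡ᵇ i)) + ∑< (q * r) f    ≤⟨ +-mono-≤ (∑<-≡ᵇ c r) (residues r c q) ⟩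
  suc q                                     ∎
  where
  open ≤-Reasoning
  f : ℕ → ℕ
  f i = 𝟙 (c ≡ᵇ i % r)

-- n is rounded up to a multiple of r that exceeds it by at most r; there the class has at most one
-- element in each period.
residueClass : ∀ r → .{{_ : NonZero r}} → ∀ c n → r * (∑[ j ∈ allFin n ] 𝟙 (c ≡ᵇ toℕ j % r)) ≤ n + r
residueClass r c n = begin
  r * (∑[ j ∈ allFin n ] 𝟙 (c ≡ᵇ toℕ j % r)) ≡⟨ cong (r *_) (∑-tabulate n (λ j → j) _ f λ _ → refl) ⟩
  r * ∑< n f                                 ≤⟨ *-monoʳ-≤ r (∑<-monoˡ f n≤) ⟩
  r * ∑< (suc (n / r) * r) f                 ≤⟨ *-monoʳ-≤ r (residues r c (suc (n / r))) ⟩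
  r * suc (n / r)                            ≡⟨ trans (*-comm r _) (+-comm r _) ⟩
  n / r * r + r                              ≤⟨ +-monoˡ-≤ r (≤-trans (m≤n+m _ (n % r)) (≤-reflexive (sym (m≡m%n+[m/n]*n n r)))) ⟩
  n + r                                      ∎
  where
  open ≤-Reasoning
  f : ℕ → ℕ
  f i = 𝟙 (c ≡ᵇ i % r)
  n≤ : n ≤ suc (n / r) * r
  n≤ = ≤-trans (≤-reflexive (m≡m%n+[m/n]*n n r)) (+-monoˡ-≤ _ (<⇒≤ (m%n<n n r)))

turán : ∀ n r → .{{NonZero r}} → Graph12 n
turán n r = record { one = λ _ → true ; two = λ i j → not (toℕ i % r ≡ᵇ toℕ j % r) }

turán-edges1 : ∀ n r → .{{_ : NonZero r}} → edges1 (turán n r) ≡ n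
turán-edges1 n r = trans (length-filterᵇ (λ _ → true) (allFin n))
  (trans (∑-const (allFin n) 1) (trans (*-identityʳ _) (length-allFin n)))

≡ᵇ-sym : ∀ m n → (m ≡ᵇ n) ≡ (n ≡ᵇ m)
≡ᵇ-sym zero    zero    = refl
≡ᵇ-sym zero    (suc n) = refl
≡ᵇ-sym (suc m) zero    = refl
≡ᵇ-sym (suc m) (suc n) = ≡ᵇ-sym m n

<⇒<ᵇ≡true : ∀ {m n} → m < n → (m <ᵇ n) ≡ true
<⇒<ᵇ≡true {zero}  (s≤s _)         = refl
<⇒<ᵇ≡true {suc m} (s≤s m<n@(s≤s _)) = <⇒<ᵇ≡true m<n

≡ᵇ-refl : ∀ n → (n ≡ᵇ n) ≡ true
≡ᵇ-refl zero    = refl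
≡ᵇ-refl (suc n) = ≡ᵇ-refl n

turán-proper : ∀ n r → .{{_ : NonZero r}} → ∀ i j → adj (turán n r) i j ≡ true → toℕ i % r ≢ toℕ j % r
turán-proper n r i j ij eq rewrite eq | ≡ᵇ-refl (toℕ j % r) with toℕ i <ᵇ toℕ j | toℕ j <ᵇ toℕ i | ij
... | false | false | ()
... | false | true  | ()
... | true  | false | ()
... | true  | true  | ()

turán-pair : ∀ n r → .{{_ : NonZero r}} → ∀ i j →
             1 ≤ 𝟙 (adj (turán n r) i j) + 𝟙 (toℕ i % r ≡ᵇ toℕ j % r)
turán-pair n r i j with <-cmp (toℕ i) (toℕ j)
... | tri< i<j _ _ rewrite <⇒<ᵇ≡true i<j = left (toℕ i % r ≡ᵇ toℕ j % r) _
  where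
  left : ∀ b c → 1 ≤ 𝟙 (not b ∨ c) + 𝟙 b
  left true  c = m≤n+m 1 _
  left false c = ≤-refl
... | tri≈ _ i≡j _ rewrite i≡j | ≡ᵇ-refl (toℕ j % r) = m≤n+m 1 _
... | tri> _ _ j<i rewrite ≡ᵇ-sym (toℕ j % r) (toℕ i % r) | <⇒<ᵇ≡true j<i = right (toℕ i % r ≡ᵇ toℕ j % r) _
  where
  right : ∀ b c → 1 ≤ 𝟙 (c ∨ not b) + 𝟙 b
  right true  c     = m≤n+m 1 _
  right false false = ≤-refl
  right false true  = ≤-refl

-- Each vertex misses only its own residue class, itself included, and by `residueClass` that class
-- has at most n/r + 1 elements.
turán-edges2 : ∀ n r → .{{_ : NonZero r}} → r * (n * n) ≤ r * (2 * edges2 (turán n r)) + n * (n + r)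
turán-edges2 n r = begin
  r * (n * n)
    ≡⟨ cong (r *_) (trans (∑-const vs n) (cong (_* n) (length-allFin n))) ⟨
  r * (∑[ _ ∈ vs ] n)
    ≤⟨ *-monoʳ-≤ r (∑-mono vs λ {i} _ → row i) ⟩
  r * (∑[ i ∈ vs ] (degree i vs + same i))
    ≡⟨ trans (cong (r *_) (∑-+ vs _ _)) (*-distribˡ-+ r _ (∑ vs same)) ⟩
  r * vol Γ vs + r * ∑ vs same
    ≡⟨ cong₂ (λ x y → r * x + y) (sym (edges2-vol (turán n r))) (sym (∑-* vs r same)) ⟩
  r * (2 * edges2 (turán n r)) + (∑[ i ∈ vs ] r * same i)
    ≤⟨ +-monoʳ-≤ _ (∑-mono vs λ {i} _ → residueClass r (toℕ i % r) n) ⟩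
  r * (2 * edges2 (turán n r)) + (∑[ _ ∈ vs ] (n + r))
    ≡⟨ cong (r * (2 * edges2 (turán n r)) +_) (trans (∑-const vs (n + r)) (cong (_* (n + r)) (length-allFin n))) ⟩
  r * (2 * edges2 (turán n r)) + n * (n + r) ∎
  where
  open ≤-Reasoning
  vs = allFin n
  Γ = graph (turán n r)
  degree = deg Γ
  same : Fin n → ℕ
  same i = ∑[ j ∈ vs ] 𝟙 (toℕ i % r ≡ᵇ toℕ j % r)
  row : ∀ i → n ≤ degree i vs + same i
  row i = begin
    n                    ≡⟨ trans (∑-const vs 1) (trans (*-identityʳ _) (length-allFin n)) ⟨
    (∑[ _ ∈ vs ] 1)       ≤⟨ ∑-mono vs (λ {j} _ → turán-pair n r i j) ⟩
    (∑[ j ∈ vs ] (𝟙 (adj (turán n r) i j) + 𝟙 (toℕ i % r ≡ᵇ toℕ j % r))) ≡⟨ ∑-+ vs _ _ ⟩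
    degree i vs + same i  ∎

turán-lubell : ∀ n r′ k → .{{_ : NonZero k}} → 2 + k ≤ n →
               frac 2 1 ℚ.≤ lubell (turán n (2 + r′)) ℚ.+ frac 1 (2 + r′) ℚ.+ frac 1 k
turán-lubell (suc n′@(suc n″)) r′ k (s≤s (s≤s k≤n″)) =
  subst₂ (λ e c → frac 2 1 ℚ.≤ frac e c ℚ.+ frac e₂ (n C 2) ℚ.+ frac 1 r ℚ.+ frac 1 k)
    (sym (turán-edges1 n r)) (sym (nC1≡n n))
    (lower-clear r k n′ (n C 2) n e₂ {{_}} {{it}} {{nC2≢0 n″}} (2*nC2 n′)
      -- The edge count yields a Lubell value of at least 2 - 1/r - 1/(r n′). The slack is n(r n′ -
      -- k), written through d = n′ - k, and k ≤ n′ makes it nonnegative.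
      (+-compensate-≤ (*-monoʳ-≤ k (turán-edges2 n r))
        (subst Identity (m+[n∸m]≡n (m≤n⇒m≤1+n k≤n″)) (identity r′ k (n′ ∸ k) e₂))))
  where
  n = suc n′
  r = 2 + r′
  e₂ = edges2 (turán n r)
  Identity : ℕ → Set
  Identity n′ = let n = 1 + n′ in
    ((n * n′ + 2 * e₂) * r + n * n′) * k + n * n′ * r + k * (r * (n * n)) ≡
    2 * (n * n′) * r * k + k * (r * (2 * e₂) + n * (n + r)) +
    (1 + (k + (suc n″ ∸ k))) * (suc n″ ∸ k + (1 + r′) * (k + (suc n″ ∸ k)))
  identity : ∀ r′ k d e₂ →
    (((1 + (k + d)) * (k + d) + 2 * e₂) * (2 + r′) + (1 + (k + d)) * (k + d)) * k + (1 + (k + d)) * (k + d) * (2 + r′) +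
      k * ((2 + r′) * ((1 + (k + d)) * (1 + (k + d)))) ≡
    2 * ((1 + (k + d)) * (k + d)) * (2 + r′) * k + k * ((2 + r′) * (2 * e₂) + (1 + (k + d)) * ((1 + (k + d)) + (2 + r′))) +
      (1 + (k + d)) * (d + (1 + r′) * (k + d))
  identity = solve-∀

-- The residue of the image modulo r is a proper colouring. The obstruction lies in the 2-edges
-- alone, so the host can carry every singleton and collect the full 1 from them.
contains⇒colourable : ∀ {m} (H : Graph12 m) n r → .{{_ : NonZero r}} → Contains (turán n r) H → Colourable H r
contains⇒colourable H n r (φ , _ , _ , edges) =
  (λ v → fromℕ< (m%n<n (toℕ (φ v)) r)) ,
  λ i j ij eq → turán-proper n r (φ i) (φ j) (edges i j ij) (fromℕ<-injective _ _ _ _ eq)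

-- Assembling the two bounds into the Turán density.

Colourable-mono : ∀ {m} (H : Graph12 m) {j k} → j ≤ k → Colourable H j → Colourable H k
Colourable-mono H j≤k (c , proper) =
  (λ v → inject≤ (c v) j≤k) , λ i j ij eq → proper i j ij (inject≤-injective j≤k j≤k _ _ eq)

module _ (x y e : ℚ) where

  x-y+e+y : x ℚ.- y ℚ.+ e ℚ.+ y ≡ x ℚ.+ e
  x-y+e+y = begin
    x ℚ.- y ℚ.+ e ℚ.+ y         ≡⟨ ℚ.+-assoc (x ℚ.- y) e y ⟩
    x ℚ.- y ℚ.+ (e ℚ.+ y)       ≡⟨ ℚ.+-assoc x (ℚ.- y) (e ℚ.+ y) ⟩
    x ℚ.+ (ℚ.- y ℚ.+ (e ℚ.+ y)) ≡⟨ cong (λ z → x ℚ.+ (ℚ.- y ℚ.+ z)) (ℚ.+-comm e y) ⟩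
    x ℚ.+ (ℚ.- y ℚ.+ (y ℚ.+ e)) ≡⟨ cong (x ℚ.+_) (ℚ.+-assoc (ℚ.- y) y e) ⟨
    x ℚ.+ (ℚ.- y ℚ.+ y ℚ.+ e)   ≡⟨ cong (λ z → x ℚ.+ (z ℚ.+ e)) (ℚ.+-inverseˡ y) ⟩
    x ℚ.+ (0ℚ ℚ.+ e)            ≡⟨ cong (x ℚ.+_) (ℚ.+-identityˡ e) ⟩
    x ℚ.+ e                     ∎
    where open ≡-Reasoning

x+y-y : ∀ x y → x ℚ.+ y ℚ.- y ≡ x
x+y-y x y = trans (ℚ.+-assoc x y (ℚ.- y)) (trans (cong (x ℚ.+_) (ℚ.+-inverseʳ y)) (ℚ.+-identityʳ x))

≤+⇒-≤ : ∀ {x z} y → x ℚ.≤ z ℚ.+ y → x ℚ.- y ℚ.≤ z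
≤+⇒-≤ {x} {z} y x≤z+y = subst (x ℚ.- y ℚ.≤_) (x+y-y z y) (ℚ.+-monoˡ-≤ (ℚ.- y) x≤z+y)

theorem1p3 : ∀ {m} (H : Graph12 m) → Is12Graph H → ¬ Bipartite2 H →
    ∀ (χ : ℕ) → IsChromaticNumber H χ →
    TuranDensityIs H (frac 2 1 ℚ.- frac 1 (χ ∸ 1))
theorem1p3 H _ ¬bip 0 (colouring , _) = contradiction (Colourable-mono H z≤n colouring) ¬bip
theorem1p3 H _ ¬bip 1 (colouring , _) = contradiction (Colourable-mono H (s≤s z≤n) colouring) ¬bip
theorem1p3 H _ ¬bip 2 (colouring , _) = contradiction colouring ¬bip
theorem1p3 {m} H _ ¬bip (suc (suc (suc r′))) (colouring , minimal) ε 0<ε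
  = upperThreshold r′ k (suc m) + (2 + k) , λ n n-large →
    (λ G H-free → decidable-stable (lubell G ℚ.≤? L ℚ.+ ε) λ large →
      H-free (upper H r′ k colouring n (≤-trans (m≤m+n (upperThreshold r′ k (suc m)) _) n-large) G (lubell-large G (ℚ.<⇒≤ (ℚ.≰⇒> large)))))
    , turán n r
    , (λ contained → <⇒≱ (n<1+n r) (minimal r (contains⇒colourable H n r contained)))
    , lubell-turán n (≤-trans (m≤n+m _ (upperThreshold r′ k (suc m))) n-large)
  where
  r = 2 + r′
  L = frac 2 1 ℚ.- frac 1 r
  k = suc (proj₁ (archimedean ε 0<ε))
  1/k≤ε = proj₂ (archimedean ε 0<ε)
  lubell-large : ∀ {n} (G : Graph12 n) → L ℚ.+ ε ℚ.≤ lubell G →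
                 frac 2 1 ℚ.+ frac 1 k ℚ.≤ lubell G ℚ.+ frac 1 r
  lubell-large G le = begin
    frac 2 1 ℚ.+ frac 1 k ≤⟨ ℚ.+-monoʳ-≤ (frac 2 1) 1/k≤ε ⟩
    frac 2 1 ℚ.+ ε                 ≡⟨ x-y+e+y (frac 2 1) (frac 1 r) ε ⟨
    L ℚ.+ ε ℚ.+ frac 1 r           ≤⟨ ℚ.+-monoˡ-≤ (frac 1 r) le ⟩
    lubell G ℚ.+ frac 1 r          ∎
    where open ℚ.≤-Reasoning
  lubell-turán : ∀ n → 2 + k ≤ n → L ℚ.- ε ℚ.≤ lubell (turán n r)
  lubell-turán n n-large = ≤+⇒-≤ ε (ℚ.≤-trans
    (≤+⇒-≤ (frac 1 r) (begin
      frac 2 1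
        ≤⟨ turán-lubell n r′ k n-large ⟩
      lubell (turán n r) ℚ.+ frac 1 r ℚ.+ frac 1 k
        ≡⟨ xy+z (lubell (turán n r)) (frac 1 r) (frac 1 k) ⟩
      lubell (turán n r) ℚ.+ frac 1 k ℚ.+ frac 1 r ∎))
    (ℚ.+-monoʳ-≤ (lubell (turán n r)) 1/k≤ε))
    where
    open ℚ.≤-Reasoning
    xy+z : ∀ x y z → x ℚ.+ y ℚ.+ z ≡ x ℚ.+ z ℚ.+ y
    xy+z x y z = trans (ℚ.+-assoc x y z) (trans (cong (x ℚ.+_) (ℚ.+-comm y z)) (sym (ℚ.+-assoc x z y)))
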